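{- Let $\mathcal{A}$ be a separating union-closed family with base set $[n]$ and height $h\le 3$. Then $\mathrm{Avg}(\mathcal{A})=\frac{1}{|\mathcal{A}|}\sum_{A\in\mathcal{A}}|A| \geq \frac{n}{2}$.
   Context: A family of sets $\mathcal{A}$ is union-closed if it is a finite family of distinct finite sets with at least one nonempty member set, and $X,Y\in\mathcal{A}$ implies $X\cup Y\in\mathcal{A}$ (the empty set may be a member). The base set $\bigcup_{A\in\mathcal{A}}A$ is denoted $[n]=\{1,\dots,n\}$. $\mathcal{A}$ is separating if for any two distinct $x,y\in[n]$ there is $A\in\mathcal{A}$ containing exactly one of $x,y$. A chain in $\mathcal{A}$ is a subfamily any two distinct members of which are comparable under proper inclusion; the height $h$ of $\mathcal{A}$ is the maximum size of a chain in $\mathcal{A}$. -}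

module Defs where

open import Data.Fin using (Fin)
open import Data.Fin.Subset using (Subset; ∣_∣; ⋃; _∪_; _⊂_; Nonempty) renaming (_∈_ to _∈ₛ_; _∉_ to _∉ₛ_)
open import Data.Integer using (+_)
open import Data.List using (List; length; map)
open import Data.List.Membership.Propositional using (_∈_)
open import Data.List.Relation.Binary.Subset.Propositional using (_⊆_)
open import Data.List.Relation.Unary.Any using (here; there)
open import Data.List.Relation.Unary.Unique.Propositional using (Unique)
open import Data.Nat using (ℕ; _≤_; NonZero)
open import Data.Nat.ListAction using (sum)
open import Data.Product using (∃-syntax; _×_; _,_)
open import Data.Rational using (ℚ; _/_)
open import Data.Sum using (_⊎_)
open import Relation.Binary.PropositionalEquality using (_≡_; _≢_)

-- The ambient set is Fin n; an element of Fin n need not lie in any member,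
-- so "base set [n]" is the separate condition baseSet 𝒜 ≡ ⊤.
record UnionClosedFamily (n : ℕ) : Set where
  field
    members     : List (Subset n)
    distinct    : Unique members
    hasNonempty : ∃[ A ] (A ∈ members × Nonempty A)
    ∪-closed    : ∀ {X Y} → X ∈ members → Y ∈ members → X ∪ Y ∈ members

open UnionClosedFamily public

∈⇒length-nonZero : ∀ {A : Set} {x : A} {xs : List A} → x ∈ xs → NonZero (length xs)
∈⇒length-nonZero (here _)  = _
∈⇒length-nonZero (there _) = _

module _ {n : ℕ} (𝒜 : UnionClosedFamily n) where

  baseSet : Subset n
  baseSet = ⋃ (members 𝒜)

  Separating : Set
  Separating = ∀ (x y : Fin n) → x ≢ y →
    ∃[ A ] (A ∈ members 𝒜 × ((x ∈ₛ A × y ∉ₛ A) ⊎ (x ∉ₛ A × y ∈ₛ A)))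

  -- C is duplicate-free, so length C is the size of the chain.
  record IsChain (C : List (Subset n)) : Set where
    field
      distinct   : Unique C
      subfamily  : C ⊆ members 𝒜
      comparable : ∀ {X Y} → X ∈ C → Y ∈ C → X ≢ Y → X ⊂ Y ⊎ Y ⊂ X

  record IsHeight (h : ℕ) : Set where
    field
      attained : ∃[ C ] (IsChain C × length C ≡ h)
      maximal  : ∀ C → IsChain C → length C ≤ h

  size-nonZero : NonZero (length (members 𝒜))
  size-nonZero = let (_ , A∈𝒜 , _) = hasNonempty 𝒜 in ∈⇒length-nonZero A∈𝒜

  Avg : ℚ
  Avg = _/_ (+ sum (map ∣_∣ (members 𝒜))) (length (members 𝒜)) {{size-nonZero}}

{-# OPTIONS --safe #-}
-- Let V be the set of elements that some member of 𝒜 omits, v = |V|, and count incidences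
-- "x ∉ A".  Two distinct members X, Y jointly omit at most one element: if X ∪ Y omits x ≠ y
-- and A separates x from y, then X ⊂ X ∪ Y ⊂ X ∪ Y ∪ A ⊂ [n] (or the same with Y first) is a
-- chain of size 4.  Hence no two members share a pair of omitted elements, and with m the
-- number of members that omit something, 2 · #incidences ≤ v (v - 1) + 2 m.  By separation,
-- x ↦ ⋃ {A ∈ 𝒜 : x ∉ A} injects V into those m members, so v ≤ m < |𝒜|.  For v ≥ 2 this
-- gives 2 · #incidences ≤ v |𝒜| ≤ n |𝒜|, which is the claim; for v ≤ 1 moreover m ≤ v.
module Submission where

open import Defs
open import Data.Bool using (true; false)
open import Data.Empty using (⊥)
open import Data.Fin using (Fin; zero; suc)
open import Data.Fin.Properties using (suc-injective) renaming (_≟_ to _≟ᶠ_)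
open import Data.Fin.Subset using (Subset; ⊤; ∣_∣; ⋃; _∪_; _⊂_; inside; outside) renaming (_∈_ to _∈ₛ_; _∉_ to _∉ₛ_; _⊆_ to _⊆ₛ_)
open import Data.Fin.Subset.Properties using (_∈?_; ∉⊥; ∈⊤; ⊆⊤; ⊆-antisym; ⊂-trans; ⊂-irref; p⊆p∪q; q⊆p∪q; x∈p∪q⁻; ∪-identityʳ)
open import Data.Integer using (+_)
open import Data.Integer.Properties using (pos-*)
open import Data.List using (List; []; _∷_; _++_; length; map; filter; allFin)
open import Data.List.Membership.Propositional using (_∈_; find; lose)
open import Data.List.Membership.Propositional.Properties using (∈-∃++; ∈-++⁻; ∈-++⁺ˡ; ∈-++⁺ʳ; ∈-filter⁺; ∈-filter⁻; ∈-allFin; ∈-map⁻)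
open import Data.List.Properties using (length-++-sucʳ; length-map; length-filter; length-tabulate; filter-notAll)
open import Data.List.Relation.Binary.Subset.Propositional using (_⊆_)
open import Data.List.Relation.Unary.All as All using ([]; _∷_)
open import Data.List.Relation.Unary.AllPairs as AllPairs using (AllPairs; []; _∷_)
open import Data.List.Relation.Unary.Any using (Any; here; there; any?)
open import Data.List.Relation.Unary.Linked using (Linked; [-]; _∷_)
open import Data.List.Relation.Unary.Linked.Properties using (Linked⇒AllPairs)
open import Data.List.Relation.Unary.Unique.Propositional using (Unique)
import Data.List.Relation.Unary.Unique.Propositional.Properties as Unique
open import Data.Nat using (ℕ; zero; suc; _+_; _*_; _≤_; _<_; z≤n; s≤s; NonZero)
open import Data.Nat.ListAction using (sum)
open import Data.Nat.Properties hiding (suc-injective)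
open import Algebra.Properties.CommutativeSemigroup +-commutativeSemigroup using (x∙yz≈y∙xz; interchange)
open import Data.Nat.Tactic.RingSolver using (solve-∀)
open import Data.Product using (_×_; _,_; proj₁; proj₂; ∃-syntax)
open import Data.Rational using (_/_; _≥_)
import Data.Rational as ℚ
import Data.Rational.Properties as ℚ
import Data.Rational.Unnormalised as ℚᵘ
import Data.Rational.Unnormalised.Properties as ℚᵘ
import Data.Integer as ℤ
open import Data.Sum using (_⊎_; inj₁; inj₂; [_,_]′)
open import Data.Vec using ([]; _∷_)
import Data.Vec as Vec
open import Function using (_∘_; id; case_of_)
open import Relation.Binary.PropositionalEquality using (_≡_; _≢_; refl; sym; trans; cong; subst; subst₂)
open import Relation.Nullary using (Dec; yes; no; does; contradiction)
open import Relation.Nullary.Decidable using (¬?; _×-dec_; decidable-stable)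

-- Counting in lists

module _ {A B : Set} (R : A → B → Set) where

  -- Match `x` with some `y` and delete that `y` from `ys`; injectivity keeps every later element
  -- away from it. Using a relation instead of a function lets partners come straight from existence
  -- proofs.
  pigeonhole : ∀ {xs ys} → Unique xs →
    (∀ {x} → x ∈ xs → ∃[ y ] (y ∈ ys × R x y)) →
    (∀ {x x′ y} → x ∈ xs → x′ ∈ xs → y ∈ ys → R x y → R x′ y → x ≡ x′) →
    length xs ≤ length ys
  pigeonhole {[]} _ _ _ = z≤n
  pigeonhole {x ∷ xs} (x∉xs ∷ uniq) total inj with total (here refl)
  ... | y , y∈ys , Rxy with ∈-∃++ y∈ys
  ...   | as , bs , refl =
    subst (suc (length xs) ≤_) (sym (length-++-sucʳ as y bs))
      (s≤s (pigeonhole uniq total′ λ p p′ q → inj (there p) (there p′) (weaken q)))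
    where
    weaken : ∀ {z} → z ∈ as ++ bs → z ∈ as ++ y ∷ bs
    weaken = [ ∈-++⁺ˡ , ∈-++⁺ʳ as ∘ there ]′ ∘ ∈-++⁻ as

    total′ : ∀ {x′} → x′ ∈ xs → ∃[ z ] (z ∈ as ++ bs × R x′ z)
    total′ x′∈xs with total (there x′∈xs)
    ... | z , z∈ , Rx′z with ∈-++⁻ as z∈
    ...   | inj₁ z∈as           = z , ∈-++⁺ˡ z∈as , Rx′z
    ...   | inj₂ (there z∈bs)   = z , ∈-++⁺ʳ as z∈bs , Rx′z
    ...   | inj₂ (here refl)    = contradiction
      (inj (here refl) (there x′∈xs) y∈ys Rxy Rx′z) (All.lookup x∉xs x′∈xs)

Unique-⊆⇒length-≤ : ∀ {A : Set} {xs ys : List A} → Unique xs → xs ⊆ ys → length xs ≤ length ys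
Unique-⊆⇒length-≤ uniq xs⊆ys =
  pigeonhole _≡_ uniq (λ x∈ → _ , xs⊆ys x∈ , refl) (λ { _ _ _ refl refl → refl })

module _ {A B : Set} {R : A → B → Set} (R? : ∀ a b → Dec (R a b)) where

  degree : List B → A → ℕ
  degree ys a = length (filter (R? a) ys)

  touching : List B → List A → List A
  touching ys = filter (λ a → any? (R? a) ys)

  sum-degree-∷ : ∀ y ys xs → sum (map (degree (y ∷ ys)) xs) ≡
    length (filter (λ a → R? a y) xs) + sum (map (degree ys) xs)
  sum-degree-∷ y ys [] = refl
  sum-degree-∷ y ys (a ∷ xs) rewrite sum-degree-∷ y ys xs with does (R? a y)
  ... | true  = cong suc (x∙yz≈y∙xz (degree ys a) (length (filter (λ a → R? a y) xs)) _)
  ... | false = x∙yz≈y∙xz (degree ys a) (length (filter (λ a → R? a y) xs)) _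

  -- Inclusion-exclusion for two sets: the elements related to `y`, and those related to something
  -- in `ys`.
  touching-∷ : ∀ y ys xs →
    length (filter (λ a → R? a y) xs) + length (touching ys xs) ≡
    length (touching (y ∷ ys) xs) + length (filter (λ a → R? a y ×-dec any? (R? a) ys) xs)
  touching-∷ y ys [] = refl
  touching-∷ y ys (a ∷ xs) with ih ← touching-∷ y ys xs | does (R? a y) | does (any? (R? a) ys)
  ... | true  | true  = cong suc (trans (+-suc _ _) (trans (cong suc ih) (sym (+-suc _ _))))
  ... | true  | false = cong suc ih
  ... | false | true  = trans (+-suc _ _) (cong suc ih)
  ... | false | false = ih

  -- The hypothesis says that R contains no 2 × 2 rectangle.  Adding y to ys creates a new
  -- incidence with each a related to y; such an a is either newly touching or already related
  -- to some element of ys, and the latter kind injects into ys.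
  2*sum-degree-≤ : ∀ {xs ys} → Unique xs → Unique ys →
    (∀ {a a′ b b′} → a ∈ xs → a′ ∈ xs → b ≢ b′ → R a b → R a′ b → R a b′ → R a′ b′ → a ≡ a′) →
    2 * sum (map (degree ys) xs) + length ys ≤ length ys * length ys + 2 * length (touching ys xs)
  2*sum-degree-≤ {xs} {[]} _ _ _ = ≤-trans (≤-reflexive (sum-zero xs)) z≤n
    where
    sum-zero : ∀ zs → 2 * sum (map (degree []) zs) + 0 ≡ 0
    sum-zero []       = refl
    sum-zero (_ ∷ zs) = sum-zero zs
  2*sum-degree-≤ {xs} {y ∷ ys} uniq-xs (y∉ys ∷ uniq-ys) rect = begin
    2 * sum (map (degree (y ∷ ys)) xs) + suc v ≡⟨ cong (λ s → 2 * s + suc v) (sum-degree-∷ y ys xs) ⟩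
    2 * (d + S) + suc v                        ≡⟨ expand d S v ⟩
    suc (2 * d + (2 * S + v))                  ≤⟨ s≤s (+-monoʳ-≤ (2 * d) (2*sum-degree-≤ uniq-xs uniq-ys rect)) ⟩
    suc (2 * d + (v * v + 2 * t))              ≡⟨ cong suc (collect d v t) ⟩
    suc (v * v + 2 * (d + t))                  ≡⟨ cong (λ s → suc (v * v + 2 * s)) (touching-∷ y ys xs) ⟩
    suc (v * v + 2 * (t′ + length both))       ≤⟨ s≤s (+-monoʳ-≤ (v * v) (*-monoʳ-≤ 2 (+-monoʳ-≤ t′ both≤v))) ⟩
    suc (v * v + 2 * (t′ + v))                 ≡⟨ square v t′ ⟩
    suc v * suc v + 2 * t′                     ∎
    where
    open ≤-Reasoning
    v = length ys
    d = length (filter (λ a → R? a y) xs)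
    S = sum (map (degree ys) xs)
    t = length (touching ys xs)
    t′ = length (touching (y ∷ ys) xs)
    both? = λ a → R? a y ×-dec any? (R? a) ys
    both = filter both? xs

    expand : ∀ d S v → 2 * (d + S) + (1 + v) ≡ 1 + (2 * d + (2 * S + v))
    expand = solve-∀
    collect : ∀ d v t → 2 * d + (v * v + 2 * t) ≡ v * v + 2 * (d + t)
    collect = solve-∀
    square : ∀ v t′ → 1 + (v * v + 2 * (t′ + v)) ≡ (1 + v) * (1 + v) + 2 * t′
    square = solve-∀

    both≤v : length both ≤ v
    both≤v = pigeonhole R (Unique.filter⁺ both? uniq-xs)
      (λ a∈ → find (proj₂ (proj₂ (∈-filter⁻ both? {xs = xs} a∈))))
      λ a∈ a′∈ b∈ Rab Ra′b →
        let a∈xs  , Ray  , _ = ∈-filter⁻ both? {xs = xs} a∈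
            a′∈xs , Ra′y , _ = ∈-filter⁻ both? {xs = xs} a′∈
        in rect a∈xs a′∈xs (All.lookup y∉ys b∈) Ray Ra′y Rab Ra′b

length*≤sum+sum : ∀ {A : Set} {n} (f g : A → ℕ) xs → (∀ {a} → a ∈ xs → n ≤ f a + g a) →
  n * length xs ≤ sum (map f xs) + sum (map g xs)
length*≤sum+sum {n = n} f g [] n≤ = ≤-reflexive (*-zeroʳ n)
length*≤sum+sum {n = n} f g (a ∷ xs) n≤ = begin
  n * suc (length xs)                             ≡⟨ *-suc n (length xs) ⟩
  n + n * length xs                               ≤⟨ +-mono-≤ (n≤ (here refl)) (length*≤sum+sum f g xs (n≤ ∘ there)) ⟩
  (f a + g a) + (sum (map f xs) + sum (map g xs)) ≡⟨ interchange (f a) (g a) _ _ ⟩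
  (f a + sum (map f xs)) + (g a + sum (map g xs)) ∎
  where
  open ≤-Reasoning

AllPairs-comparable : ∀ {A : Set} {R : A → A → Set} {xs} → AllPairs R xs →
  ∀ {x y} → x ∈ xs → y ∈ xs → x ≢ y → R x y ⊎ R y x
AllPairs-comparable (_   ∷ _)   (here refl) (here refl) x≢y = contradiction refl x≢y
AllPairs-comparable (Rxs ∷ _)   (here refl) (there y∈)  _   = inj₁ (All.lookup Rxs y∈)
AllPairs-comparable (Rxs ∷ _)   (there x∈)  (here refl) _   = inj₂ (All.lookup Rxs x∈)
AllPairs-comparable (_   ∷ Rxs) (there x∈)  (there y∈)  x≢y = AllPairs-comparable Rxs x∈ y∈ x≢y

-- Inequalities in ℕ and ℚ

-- To be read with `S` incidences, `v` omittable elements, `m` deficient members and `g` members in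
-- all. The summand `v` on the left replaces a truncated `v * (v - 1)` on the right. The last
-- hypothesis covers `v ≤ 1`, where the general estimate can fail.
incidence-bound : ∀ S {v m g} → 2 * S + v ≤ v * v + 2 * m → v ≤ m → m < g →
  (v ≤ 1 → m ≤ v) → 2 * S ≤ v * g
incidence-bound S {zero} bound _ _ m≤v with m≤v z≤n
... | z≤n = subst (_≤ 0) (+-identityʳ (2 * S)) bound
incidence-bound S {suc zero} {m} {g} bound 1≤m m<g m≤v = begin
  2 * S ≤⟨ +-cancelˡ-≤ 1 _ _ (subst (_≤ 1 + 2 * m) (+-comm (2 * S) 1) bound) ⟩
  2 * m ≤⟨ *-monoʳ-≤ 2 (m≤v ≤-refl) ⟩
  -- Here `1 ≤ m < g`, so `g` is at least 2.
  2     ≤⟨ ≤-trans (s≤s 1≤m) m<g ⟩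
  g     ≡⟨ sym (*-identityˡ g) ⟩
  1 * g ∎
  where open ≤-Reasoning
incidence-bound S {v@(suc (suc w))} {m} {suc p} bound v≤m (s≤s m≤p) _
  with m≤n⇒∃[o]m+o≡n (≤-trans v≤m m≤p)
... | d , refl = +-cancelʳ-≤ v (2 * S) (v * suc p) (begin
  2 * S + v                   ≤⟨ bound ⟩
  v * v + 2 * m               ≤⟨ +-monoʳ-≤ (v * v) (*-monoʳ-≤ 2 m≤p) ⟩
  -- With `p = v + d`, the target `v * suc p + v` exceeds this by exactly `(v - 2) * d`, which is
  -- `w * d`; hence the case split at `v = 2`.
  v * v + 2 * (v + d)         ≤⟨ m≤m+n _ (w * d) ⟩
  v * v + 2 * (v + d) + w * d ≡⟨ factor w d ⟩
  v * suc p + v               ∎)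
  where
  open ≤-Reasoning
  factor : ∀ w d → (2 + w) * (2 + w) + 2 * ((2 + w) + d) + w * d ≡ (2 + w) * (1 + ((2 + w) + d)) + (2 + w)
  factor = solve-∀

-- Double the first inequality, bound `2 * c` by `k`, and cancel one `k`.
half-≤ : ∀ {k} s c → k ≤ s + c → 2 * c ≤ k → k ≤ s * 2
half-≤ {k} s c k≤s+c 2c≤k = +-cancelʳ-≤ k k (s * 2) (begin
  k + k             ≤⟨ +-mono-≤ k≤s+c k≤s+c ⟩
  (s + c) + (s + c) ≡⟨ double s c ⟩
  s * 2 + 2 * c     ≤⟨ +-monoʳ-≤ (s * 2) 2c≤k ⟩
  s * 2 + k         ∎)
  where
  open ≤-Reasoning
  double : ∀ s c → (s + c) + (s + c) ≡ s * 2 + 2 * c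
  double = solve-∀

-- Since `_/_` reduces to lowest terms, the comparison passes through unnormalised rationals, where
-- order is cross-multiplication.
/-≤-/ : ∀ a b c d .{{_ : NonZero b}} .{{_ : NonZero d}} →
  a * d ≤ c * b → (+ a) / b ℚ.≤ (+ c) / d
/-≤-/ a (suc b) c (suc d) ad≤cb = ℚ.toℚᵘ-cancel-≤
  (ℚᵘ.≤-trans (ℚᵘ.≤-reflexive (ℚ.toℚᵘ-fromℚᵘ (ℚᵘ.mkℚᵘ (+ a) b)))
  (ℚᵘ.≤-trans (ℚᵘ.*≤* (subst₂ ℤ._≤_ (pos-* a (suc d)) (pos-* c (suc b)) (ℤ.+≤+ ad≤cb)))
  (ℚᵘ.≤-reflexive (ℚᵘ.≃-sym (ℚ.toℚᵘ-fromℚᵘ (ℚᵘ.mkℚᵘ (+ c) d))))))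

-- Subsets of Fin n

_∉?_ : ∀ {n} (A : Subset n) (x : Fin n) → Dec (x ∉ₛ A)
A ∉? x = ¬? (x ∈? A)

-- Recursion along the vector mirrors that of `∣_∣`, so the two counts add up to `n` by a direct
-- induction.
omitted : ∀ {n} → Subset n → List (Fin n)
omitted []            = []
omitted (inside  ∷ A) = map suc (omitted A)
omitted (outside ∷ A) = zero ∷ map suc (omitted A)

∣A∣+length-omitted : ∀ {n} (A : Subset n) → ∣ A ∣ + length (omitted A) ≡ n
∣A∣+length-omitted [] = refl
∣A∣+length-omitted (inside ∷ A) =
  cong suc (trans (cong (λ k → ∣ A ∣ + k) (length-map suc (omitted A))) (∣A∣+length-omitted A))
∣A∣+length-omitted (outside ∷ A) = trans (+-suc _ _)
  (cong suc (trans (cong (λ k → ∣ A ∣ + k) (length-map suc (omitted A))) (∣A∣+length-omitted A)))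

∈-omitted⇒∉ : ∀ {n} (A : Subset n) {x} → x ∈ omitted A → x ∉ₛ A
∈-omitted⇒∉ (inside ∷ A) x∈ with ∈-map⁻ suc x∈
... | _ , y∈ , refl = λ { (Vec.there y∈A) → ∈-omitted⇒∉ A y∈ y∈A }
∈-omitted⇒∉ (outside ∷ A) (here refl) = λ ()
∈-omitted⇒∉ (outside ∷ A) (there x∈) with ∈-map⁻ suc x∈
... | _ , y∈ , refl = λ { (Vec.there y∈A) → ∈-omitted⇒∉ A y∈ y∈A }

omitted-unique : ∀ {n} (A : Subset n) → Unique (omitted A)
omitted-unique [] = []
omitted-unique (inside  ∷ A) = Unique.map⁺ suc-injective (omitted-unique A)
omitted-unique (outside ∷ A) =
  All.tabulate (λ { x∈ refl → contradiction (∈-map⁻ suc x∈) λ { (_ , _ , ()) } })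
  ∷ Unique.map⁺ suc-injective (omitted-unique A)

∈⇒⊆⋃ : ∀ {n} {As : List (Subset n)} {A} → A ∈ As → A ⊆ₛ ⋃ As
∈⇒⊆⋃ (here refl) = p⊆p∪q _
∈⇒⊆⋃ (there A∈)  = q⊆p∪q _ _ ∘ ∈⇒⊆⋃ A∈

∈⋃⇒∈ : ∀ {n} (As : List (Subset n)) {x} → x ∈ₛ ⋃ As → Any (x ∈ₛ_) As
∈⋃⇒∈ []       x∈ = contradiction x∈ ∉⊥
∈⋃⇒∈ (A ∷ As) x∈ = [ here , there ∘ ∈⋃⇒∈ As ]′ (x∈p∪q⁻ A (⋃ As) x∈)

-- Union-closed families

module _ {n} (𝒜 : UnionClosedFamily n) where

  -- The witness `A ∈ As` excludes the empty list, whose union is the empty set and may fail to be a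
  -- member. The induction therefore starts at singletons.
  ⋃-closed : ∀ {A As} → A ∈ As → As ⊆ members 𝒜 → ⋃ As ∈ members 𝒜
  ⋃-closed {As = A ∷ []}     _ As⊆ = subst (_∈ members 𝒜) (sym (∪-identityʳ A)) (As⊆ (here refl))
  ⋃-closed {As = A ∷ _ ∷ _} _ As⊆ = ∪-closed 𝒜 (As⊆ (here refl)) (⋃-closed (here refl) (As⊆ ∘ there))

  increasing⇒chain : ∀ {C} → Linked _⊂_ C → C ⊆ members 𝒜 → IsChain 𝒜 C
  increasing⇒chain linked C⊆ = record
    { distinct   = AllPairs.map (λ X⊂Y X≡Y → ⊂-irref X≡Y X⊂Y) pairs
    ; subfamily  = C⊆
    ; comparable = AllPairs-comparable pairs
    }
    where pairs = Linked⇒AllPairs ⊂-trans linked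

  -- Separating families without a chain of four members

  module _ (base : baseSet 𝒜 ≡ ⊤) (sep : Separating 𝒜)
           (height≤3 : ∀ C → IsChain 𝒜 C → length C ≤ 3) where

    -- Used both as the top of the forbidden chains and as a member omitting nothing.
    ⊤-member : ⊤ ∈ members 𝒜
    ⊤-member = subst (_∈ members 𝒜) base (⋃-closed (proj₁ (proj₂ (hasNonempty 𝒜))) id)

    no-chain₄ : ∀ {X Y Z W} → X ∈ members 𝒜 → Y ∈ members 𝒜 → Z ∈ members 𝒜 → W ∈ members 𝒜 →
      X ⊂ Y → Y ⊂ Z → Z ⊂ W → ⊥
    no-chain₄ X∈ Y∈ Z∈ W∈ X⊂Y Y⊂Z Z⊂W = 1+n≰n (height≤3 _ (increasing⇒chain
      (X⊂Y ∷ Y⊂Z ∷ Z⊂W ∷ [-])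
      (All.lookup (X∈ ∷ Y∈ ∷ Z∈ ∷ W∈ ∷ []))))

    -- Some `z` in `Z` but not in `X` would give the chain `X ⊂ Z ⊂ Z ∪ A ⊂ ⊤`, where `A` separates
    -- `x` from `y`.
    omits-two⇒minimal : ∀ {X Z x y} → X ∈ members 𝒜 → Z ∈ members 𝒜 → x ≢ y →
      x ∉ₛ Z → y ∉ₛ Z → X ⊆ₛ Z → Z ⊆ₛ X
    omits-two⇒minimal {X} {Z} {x} {y} X∈ Z∈ x≢y x∉Z y∉Z X⊆Z {z} z∈Z =
      decidable-stable (z ∈? X) λ z∉X → case sep x y x≢y of λ where
        (_ , A∈ , inj₁ (x∈A , y∉A)) → no-separator z∉X A∈ x∈A y∉A x∉Z y∉Z
        (_ , A∈ , inj₂ (x∉A , y∈A)) → no-separator z∉X A∈ y∈A x∉A y∉Z x∉Z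
      where
      -- Naming `p` the element inside `A` and `q` the one outside lets both orientations of the
      -- separator share one argument; `z`, `p`, `q` witness the three strict inclusions.
      no-separator : z ∉ₛ X → ∀ {A p q} → A ∈ members 𝒜 → p ∈ₛ A → q ∉ₛ A → p ∉ₛ Z → q ∉ₛ Z → ⊥
      no-separator z∉X {A} {p} {q} A∈ p∈A q∉A p∉Z q∉Z =
        no-chain₄ X∈ Z∈ (∪-closed 𝒜 Z∈ A∈) ⊤-member
          (X⊆Z , z , z∈Z , z∉X)
          (p⊆p∪q A , p , q⊆p∪q Z A p∈A , p∉Z)
          (⊆⊤ , q , ∈⊤ , [ q∉Z , q∉A ]′ ∘ x∈p∪q⁻ Z A)

    -- `X ∪ Y` still omits both elements, so no member lies strictly below it, and `X` and `Y` both
    -- equal it. This is the rectangle-freeness that `2*sum-degree-≤` asks for.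
    common-omissions : ∀ {X Y x y} → X ∈ members 𝒜 → Y ∈ members 𝒜 → x ≢ y →
      x ∉ₛ X → x ∉ₛ Y → y ∉ₛ X → y ∉ₛ Y → X ≡ Y
    common-omissions {X} {Y} X∈ Y∈ x≢y x∉X x∉Y y∉X y∉Y = trans
      (⊆-antisym (p⊆p∪q Y) (minimal X∈ (p⊆p∪q Y)))
      (⊆-antisym (minimal Y∈ (q⊆p∪q X Y)) (q⊆p∪q X Y))
      where
      minimal : ∀ {W} → W ∈ members 𝒜 → W ⊆ₛ X ∪ Y → X ∪ Y ⊆ₛ W
      minimal W∈ = omits-two⇒minimal W∈ (∪-closed 𝒜 X∈ Y∈) x≢y
        ([ x∉X , x∉Y ]′ ∘ x∈p∪q⁻ X Y) ([ y∉X , y∉Y ]′ ∘ x∈p∪q⁻ X Y)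

    -- When this list is nonempty, its union is the largest member omitting `x`, and it will encode
    -- `x`.
    omitting : Fin n → List (Subset n)
    omitting x = filter (_∉? x) (members 𝒜)

    ∉⋃-omitting : ∀ x → x ∉ₛ ⋃ (omitting x)
    ∉⋃-omitting x x∈ with find (∈⋃⇒∈ (omitting x) x∈)
    ... | _ , A∈ , x∈A = proj₂ (∈-filter⁻ (_∉? x) {xs = members 𝒜} A∈) x∈A

    -- A member omitting `x` lies below the common union, and that union omits `y`. Applied in both
    -- directions, equal unions leave no member to separate `x` from `y`.
    ∉⇒∉ : ∀ {x y A} → ⋃ (omitting x) ≡ ⋃ (omitting y) → A ∈ members 𝒜 → x ∉ₛ A → y ∉ₛ A
    ∉⇒∉ {x} {y} eq A∈ x∉A y∈A =
      ∉⋃-omitting y (subst (y ∈ₛ_) eq (∈⇒⊆⋃ (∈-filter⁺ (_∉? x) A∈ x∉A) y∈A))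

    ⋃-omitting-injective : ∀ {x y} → ⋃ (omitting x) ≡ ⋃ (omitting y) → x ≡ y
    ⋃-omitting-injective {x} {y} eq with x ≟ᶠ y
    ... | yes x≡y = x≡y
    ... | no  x≢y with sep x y x≢y
    ...   | _ , A∈ , inj₁ (x∈A , y∉A) = contradiction x∈A (∉⇒∉ (sym eq) A∈ y∉A)
    ...   | _ , A∈ , inj₂ (x∉A , y∈A) = contradiction y∈A (∉⇒∉ eq A∈ x∉A)

    -- Incidences between members and the elements they omit

    omittable? : ∀ x → Dec (Any (x ∉ₛ_) (members 𝒜))
    omittable? x = any? (_∉? x) (members 𝒜)

    -- For `x` in this list `omitting x` is nonempty, as `⋃-closed` requires.
    V : List (Fin n)
    V = filter omittable? (allFin n)

    V-unique : Unique V
    V-unique = Unique.filter⁺ omittable? (Unique.allFin⁺ n)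

    ∉⇒∈V : ∀ {A x} → A ∈ members 𝒜 → x ∉ₛ A → x ∈ V
    ∉⇒∈V A∈ x∉A = ∈-filter⁺ omittable? (∈-allFin _) (lose A∈ x∉A)

    ∈V⇒∉ : ∀ {x} → x ∈ V → Any (x ∉ₛ_) (members 𝒜)
    ∈V⇒∉ x∈V = proj₂ (∈-filter⁻ omittable? {xs = allFin n} x∈V)

    length-V≤n : length V ≤ n
    length-V≤n = ≤-trans (length-filter omittable? (allFin n)) (≤-reflexive (length-tabulate id))

    deficient? : ∀ A → Dec (Any (_∉ₛ A) V)
    deficient? A = any? (A ∉?_) V

    deficient : List (Subset n)
    deficient = touching _∉?_ V (members 𝒜)

    length-V≤length-deficient : length V ≤ length deficient
    length-V≤length-deficient = pigeonhole (λ x A → ⋃ (omitting x) ≡ A) V-unique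
      (λ {x} x∈V → let A , A∈ , x∉A = find (∈V⇒∉ x∈V) in
        _ , ∈-filter⁺ deficient?
              (⋃-closed (∈-filter⁺ (_∉? x) A∈ x∉A) (proj₁ ∘ ∈-filter⁻ (_∉? x)))
              (lose x∈V (∉⋃-omitting x))
          , refl)
      (λ _ _ _ eq eq′ → ⋃-omitting-injective (trans eq (sym eq′)))

    length-deficient<length : length deficient < length (members 𝒜)
    length-deficient<length = filter-notAll deficient? (members 𝒜)
      -- `⊤` is the member that the filter discards, which makes the inequality strict.
      (lose ⊤-member λ any → proj₂ (proj₂ (find any)) ∈⊤)

    -- All omissions are of one single element, so any two deficient members have the same
    -- complement.
    length-deficient≤length-V : length V ≤ 1 → length deficient ≤ length V
    length-deficient≤length-V v≤1 = pigeonhole (λ A x → x ∉ₛ A)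
      (Unique.filter⁺ deficient? (distinct 𝒜))
      (λ A∈ → find (proj₂ (∈-filter⁻ deficient? {xs = members 𝒜} A∈)))
      (λ X∈ Y∈ _ x∉X x∉Y → ⊆-antisym (contained (is-member X∈) (is-member Y∈) x∉X x∉Y)
                                       (contained (is-member Y∈) (is-member X∈) x∉Y x∉X))
      where
      is-member : ∀ {A} → A ∈ deficient → A ∈ members 𝒜
      is-member = proj₁ ∘ ∈-filter⁻ deficient?

      collapse : ∀ {xs : List (Fin n)} → length xs ≤ 1 → ∀ {x y} → x ∈ xs → y ∈ xs → x ≡ y
      collapse {_ ∷ []}    _        (here refl) (here refl) = refl
      collapse {_ ∷ _ ∷ _} (s≤s ())

      contained : ∀ {X Y x} → X ∈ members 𝒜 → Y ∈ members 𝒜 → x ∉ₛ X → x ∉ₛ Y → X ⊆ₛ Y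
      contained {X} {Y} X∈ Y∈ x∉X x∉Y {z} z∈X with z ∈? Y
      ... | yes z∈Y = z∈Y
      ... | no  z∉Y = contradiction
        (subst (_∈ₛ X) (collapse v≤1 (∉⇒∈V Y∈ z∉Y) (∉⇒∈V X∈ x∉X)) z∈X) x∉X

    -- Whatever `A` omits belongs to `V`, so the degree of `A` in `V` counts all of its omissions.
    n≤∣A∣+degree : ∀ {A} → A ∈ members 𝒜 → n ≤ ∣ A ∣ + degree _∉?_ V A
    n≤∣A∣+degree {A} A∈ = subst (_≤ ∣ A ∣ + degree _∉?_ V A) (∣A∣+length-omitted A) (+-monoʳ-≤ ∣ A ∣
      (Unique-⊆⇒length-≤ (omitted-unique A) λ x∈ →
        let x∉A = ∈-omitted⇒∉ A x∈ in ∈-filter⁺ (A ∉?_) (∉⇒∈V A∈ x∉A) x∉A))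

    incidences : ℕ
    incidences = sum (map (degree _∉?_ V) (members 𝒜))

    2*incidences≤n*size : 2 * incidences ≤ n * length (members 𝒜)
    2*incidences≤n*size = ≤-trans
      (incidence-bound incidences
        (2*sum-degree-≤ _∉?_ (distinct 𝒜) V-unique common-omissions)
        length-V≤length-deficient length-deficient<length length-deficient≤length-V)
      -- The bound so far is `length V` times the size of the family; `V` consists of distinct
      -- elements of `Fin n`.
      (*-monoˡ-≤ (length (members 𝒜)) length-V≤n)

    n*size≤sum-sizes*2 : n * length (members 𝒜) ≤ sum (map ∣_∣ (members 𝒜)) * 2
    n*size≤sum-sizes*2 =
      half-≤ (sum (map ∣_∣ (members 𝒜))) incidences
        (length*≤sum+sum ∣_∣ (degree _∉?_ V) (members 𝒜) n≤∣A∣+degree) 2*incidences≤n*size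

theorem1p4 : ∀ (n : ℕ) (𝒜 : UnionClosedFamily n) → baseSet 𝒜 ≡ ⊤ → Separating 𝒜 →
    ∀ (h : ℕ) → IsHeight 𝒜 h → h ≤ 3 → Avg 𝒜 ≥ (+ n) / 2
theorem1p4 n 𝒜 base sep h isHeight h≤3 =
  /-≤-/ n 2 (sum (map ∣_∣ (members 𝒜))) (length (members 𝒜)) {{_}} {{size-nonZero 𝒜}}
    (n*size≤sum-sizes*2 𝒜 base sep λ C chain → ≤-trans (IsHeight.maximal isHeight C chain) h≤3)
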